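{- For all variable-free strictly positive formulas $A,B$ in the signature $\{\Diamond_n,\nabla_n:n<\omega\}$: $A\vdash B$ is provable in $\mathrm{RC}^\nabla$ if and only if $A^{\mathfrak{I}}\le_{\mathfrak{I}}B^{\mathfrak{I}}$.
   Context: $\mathrm{RC}^\nabla$ is the smallest set of sequents $A\vdash B$ between strictly positive formulas (built from variables and $\top$ by $\land$, $\Diamond_n$, $\nabla_n$) containing the following axioms and closed under the following rules and under substitution: (1) $A\vdash A$; $A\vdash\top$; $A\land B\vdash A$; $A\land B\vdash B$; from $A\vdash B$, $B\vdash C$ infer $A\vdash C$; from $A\vdash B$, $A\vdash C$ infer $A\vdash B\land C$; from $A\vdash B$ infer $aA\vdash aB$ for each modality $a$; (2) $aaA\vdash aA$ for each modality $a$; (3) for $m<n$: $\Diamond_nA\vdash\Diamond_mA$, $\Diamond_nA\land\Diamond_mB\vdash\Diamond_n(A\land\Diamond_mB)$, and the same two with $\nabla$ in place of $\Diamond$; (4) $A\vdash\nabla_nA$, $\Diamond_nA\vdash\nabla_nA$; (5) for $m\le n$: $\Diamond_m\nabla_nA\vdash\Diamond_mA$, $\nabla_n\Diamond_mA\vdash\Diamond_mA$. Ignatiev algebra: let $\ell(0)=0$ and $\ell(\beta)=\gamma$ if $\beta=\delta+\omega^\gamma$. $I$ is the set of $\omega$-sequences $\vec\alpha=(\alpha_0,\alpha_1,\dots)$ of ordinals $<\varepsilon_0$ with $\alpha_{i+1}\le\ell(\alpha_i)$ for all $i$. Order: $\vec\alpha\le_{\mathfrak{I}}\vec\beta$ iff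 $\alpha_i\ge\beta_i$ for all $i$. $(I,\le_{\mathfrak{I}})$ is a meet-semilattice; $\vec\alpha\land_{\mathfrak{I}}\vec\beta$ is the greatest element of $I$ below both. Operations: $\nabla_n(\vec\alpha)=(\alpha_0,\dots,\alpha_n,0,0,\dots)$; $\Diamond_n(\vec\alpha)=(\beta_0,\dots,\beta_n,0,\dots)$ where $\beta_{n+1}=0$ and $\beta_i=\alpha_i+\omega^{\beta_{i+1}}$ for $i\le n$. The value $A^{\mathfrak{I}}$ of a variable-free formula is defined recursively: $\top^{\mathfrak{I}}=(0,0,\dots)$, $(A\land B)^{\mathfrak{I}}=A^{\mathfrak{I}}\land_{\mathfrak{I}}B^{\mathfrak{I}}$, $(\Diamond_nA)^{\mathfrak{I}}=\Diamond_n(A^{\mathfrak{I}})$, $(\nabla_nA)^{\mathfrak{I}}=\nabla_n(A^{\mathfrak{I}})$. -}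

module Defs where

open import Data.Nat using (ℕ; zero; suc; _∸_; _≤ᵇ_) renaming (_<_ to _<ℕ_; _≤_ to _≤ℕ_)
open import Data.Bool using (Bool; true; false; if_then_else_)
open import Data.Product using (_×_)
open import Data.Sum using (_⊎_)
open import Data.Unit using (⊤)
open import Data.Empty using (⊥)
open import Relation.Binary.PropositionalEquality using (_≡_)

data O : Set where
  𝟎    : O
  ω^_+_ : O → O → O

data Cmp : Set where
  lt eq gt : Cmp

cmp : O → O → Cmp
cmp 𝟎 𝟎 = eq
cmp 𝟎 (ω^ _ + _) = lt
cmp (ω^ _ + _) 𝟎 = gt
cmp (ω^ a + b) (ω^ c + d) with cmp a c
... | lt = lt
... | gt = gt
... | eq = cmp b d

_<ₒ_ : O → O → Set
a <ₒ b = cmp a b ≡ lt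

_≤ₒ_ : O → O → Set
a ≤ₒ b = a <ₒ b ⊎ a ≡ b

CNF : O → Set
CNF 𝟎 = ⊤
CNF (ω^ a + 𝟎) = CNF a
CNF (ω^ a + (ω^ c + d)) = CNF a × CNF (ω^ c + d) × c ≤ₒ a

ωpow : O → O
ωpow g = ω^ g + 𝟎

_⊕_ : O → O → O
𝟎 ⊕ b = b
(ω^ a + c) ⊕ 𝟎 = ω^ a + c
(ω^ a + c) ⊕ (ω^ d + e) with cmp a d
... | lt = ω^ d + e
... | _  = ω^ a + (c ⊕ (ω^ d + e))

ℓ : O → O
ℓ 𝟎 = 𝟎
ℓ (ω^ a + 𝟎) = a
ℓ (ω^ a + (ω^ c + d)) = ℓ (ω^ c + d)

Seq : Set
Seq = ℕ → O

InI : Seq → Set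
InI α = (∀ i → CNF (α i)) × (∀ i → α (suc i) ≤ₒ ℓ (α i))

_≤I_ : Seq → Seq → Set
α ≤I β = ∀ i → β i ≤ₒ α i

IsMeet : Seq → Seq → Seq → Set
IsMeet α β m = InI m × m ≤I α × m ≤I β
             × (∀ γ → InI γ → γ ≤I α → γ ≤I β → γ ≤I m)

zeroSeq : Seq
zeroSeq _ = 𝟎

∇I : ℕ → Seq → Seq
∇I n α i = if i ≤ᵇ n then α i else 𝟎

-- β_i for i ≤ n, with k = n ∸ i remaining steps: β_i = α_i + ω^(β_{i+1}), β_{n+1} = 0
◇aux : ℕ → ℕ → Seq → O
◇aux zero    i α = α i ⊕ ωpow 𝟎
◇aux (suc k) i α = α i ⊕ ωpow (◇aux k (suc i) α)

◇I : ℕ → Seq → Seq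
◇I n α i = if i ≤ᵇ n then ◇aux (n ∸ i) i α else 𝟎

data Fm : Set where
  var : ℕ → Fm
  ⊤'  : Fm
  _∧'_ : Fm → Fm → Fm
  ◇   : ℕ → Fm → Fm
  ∇   : ℕ → Fm → Fm

data VarFree : Fm → Set where
  ⊤'  : VarFree ⊤'
  _∧'_ : ∀ {A B} → VarFree A → VarFree B → VarFree (A ∧' B)
  ◇   : ∀ {n A} → VarFree A → VarFree (◇ n A)
  ∇   : ∀ {n A} → VarFree A → VarFree (∇ n A)

sub : (ℕ → Fm) → Fm → Fm
sub σ (var x) = σ x
sub σ ⊤' = ⊤'
sub σ (A ∧' B) = sub σ A ∧' sub σ B
sub σ (◇ n A) = ◇ n (sub σ A)
sub σ (∇ n A) = ∇ n (sub σ A)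

data Mod : Set where
  dia nab : ℕ → Mod

app : Mod → Fm → Fm
app (dia n) A = ◇ n A
app (nab n) A = ∇ n A

infix 4 _⊢_
data _⊢_ : Fm → Fm → Set where
  refl⊢ : ∀ {A} → A ⊢ A
  top   : ∀ {A} → A ⊢ ⊤'
  ∧E₁   : ∀ {A B} → A ∧' B ⊢ A
  ∧E₂   : ∀ {A B} → A ∧' B ⊢ B
  cut   : ∀ {A B C} → A ⊢ B → B ⊢ C → A ⊢ C
  ∧I    : ∀ {A B C} → A ⊢ B → A ⊢ C → A ⊢ B ∧' C
  mono  : ∀ {A B} (a : Mod) → A ⊢ B → app a A ⊢ app a B
  trans4 : ∀ {A} (a : Mod) → app a (app a A) ⊢ app a A
  ◇mono : ∀ {m n A} → m <ℕ n → ◇ n A ⊢ ◇ m A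
  ◇J    : ∀ {m n A B} → m <ℕ n → ◇ n A ∧' ◇ m B ⊢ ◇ n (A ∧' ◇ m B)
  ∇mono : ∀ {m n A} → m <ℕ n → ∇ n A ⊢ ∇ m A
  ∇J    : ∀ {m n A B} → m <ℕ n → ∇ n A ∧' ∇ m B ⊢ ∇ n (A ∧' ∇ m B)
  ∇T    : ∀ {n A} → A ⊢ ∇ n A
  ◇∇    : ∀ {n A} → ◇ n A ⊢ ∇ n A
  ◇∇◇   : ∀ {m n A} → m ≤ℕ n → ◇ m (∇ n A) ⊢ ◇ m A
  ∇◇◇   : ∀ {m n A} → m ≤ℕ n → ∇ n (◇ m A) ⊢ ◇ m A
  subst⊢ : ∀ {A B} (σ : ℕ → Fm) → A ⊢ B → sub σ A ⊢ sub σ B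

-- Interpretation of variable-free formulas (relational, since ∧_I is
-- specified as "the greatest element of I below both")

data Val : Fm → Seq → Set where
  v⊤ : Val ⊤' zeroSeq
  v∧ : ∀ {A B α β m} → Val A α → Val B β → IsMeet α β m → Val (A ∧' B) m
  v◇ : ∀ {n A α} → Val A α → Val (◇ n A) (◇I n α)
  v∇ : ∀ {n A α} → Val A α → Val (∇ n A) (∇I n α)

{-# OPTIONS --safe #-}
module Submission where

-- ω^δ added to y gives the least ordinal x > y with δ ≤ ℓ(x).  Consequently both ◇ₙ and ∧ in the
-- Ignatiev algebra are computed from the top coordinate downwards, and soundness is a comparison of
-- least elements.
-- For completeness, every ordinal α has a worm W_i(α) in the modalities ◇_j, j ≥ i, with
-- W_i(δ + ω^γ) = W_{i+1}(γ) ∧ ◇_i W_i(δ), and W_i(α) ⊢ ◇_i W_i(β) for β < α.  A variable-free A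
-- with value α is equivalent to the conjunction of all ∇_i W_i(α_i).

open import Defs
open import Data.Empty using (⊥-elim)
open import Data.Nat using (ℕ; zero; suc; _+_; _∸_; _⊔_; z≤n; s≤s; _≤?_)
  renaming (_<_ to _<ℕ_; _≤_ to _≤ℕ_)
open import Data.Nat.Properties as ℕₚ using (≰⇒>)
open import Data.Product using (_×_; _,_; proj₁; proj₂; ∃-syntax)
open import Data.Sum using (_⊎_; inj₁; inj₂)
open import Data.Unit using (⊤; tt)
open import Function using (_∘_)
open import Relation.Binary.PropositionalEquality
  using (_≡_; _≢_; refl; sym; trans; cong; cong₂; subst)
open import Relation.Nullary using (¬_; yes; no)
open import Relation.Nullary.Decidable using (dec-true; dec-false)

-- The order on ordinal notations.

data _≺_ : O → O → Set where
  𝟎≺    : ∀ {a b} → 𝟎 ≺ (ω^ a + b)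
  head≺ : ∀ {a b c d} → a ≺ c → (ω^ a + b) ≺ (ω^ c + d)
  tail≺ : ∀ {a b d} → b ≺ d → (ω^ a + b) ≺ (ω^ a + d)

≺-trans : ∀ {a b c} → a ≺ b → b ≺ c → a ≺ c
≺-trans 𝟎≺        (head≺ _) = 𝟎≺
≺-trans 𝟎≺        (tail≺ _) = 𝟎≺
≺-trans (head≺ p) (head≺ q) = head≺ (≺-trans p q)
≺-trans (head≺ p) (tail≺ _) = head≺ p
≺-trans (tail≺ _) (head≺ q) = head≺ q
≺-trans (tail≺ p) (tail≺ q) = tail≺ (≺-trans p q)

≺-irrefl : ∀ {a} → ¬ (a ≺ a)
≺-irrefl (head≺ p) = ≺-irrefl p
≺-irrefl (tail≺ p) = ≺-irrefl p

data Compared (a b : O) : Cmp → Set where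
  is-lt : a ≺ b → Compared a b lt
  is-eq : a ≡ b → Compared a b eq
  is-gt : b ≺ a → Compared a b gt

cmp-correct : ∀ a b → Compared a b (cmp a b)
cmp-correct 𝟎 𝟎 = is-eq refl
cmp-correct 𝟎 (ω^ _ + _) = is-lt 𝟎≺
cmp-correct (ω^ _ + _) 𝟎 = is-gt 𝟎≺
cmp-correct (ω^ a + b) (ω^ c + d) with cmp a c | cmp-correct a c
... | lt | is-lt p = is-lt (head≺ p)
... | gt | is-gt p = is-gt (head≺ p)
... | eq | is-eq refl with cmp b d | cmp-correct b d
...   | lt | is-lt p    = is-lt (tail≺ p)
...   | gt | is-gt p    = is-gt (tail≺ p)
...   | eq | is-eq refl = is-eq refl

<ₒ⇒≺ : ∀ {a b} → a <ₒ b → a ≺ b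
<ₒ⇒≺ {a} {b} p with cmp a b | cmp-correct a b
<ₒ⇒≺ refl | lt | is-lt q = q

≺⇒<ₒ : ∀ {a b} → a ≺ b → a <ₒ b
≺⇒<ₒ {a} {b} p with cmp a b | cmp-correct a b
... | lt | is-lt _    = refl
... | eq | is-eq refl = ⊥-elim (≺-irrefl p)
... | gt | is-gt q    = ⊥-elim (≺-irrefl (≺-trans p q))

_≼_ : O → O → Set
a ≼ b = a ≺ b ⊎ a ≡ b

≤ₒ⇒≼ : ∀ {a b} → a ≤ₒ b → a ≼ b
≤ₒ⇒≼ (inj₁ p) = inj₁ (<ₒ⇒≺ p)
≤ₒ⇒≼ (inj₂ e) = inj₂ e

≼⇒≤ₒ : ∀ {a b} → a ≼ b → a ≤ₒ b
≼⇒≤ₒ (inj₁ p) = inj₁ (≺⇒<ₒ p)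
≼⇒≤ₒ (inj₂ e) = inj₂ e

≼-refl : ∀ {a} → a ≼ a
≼-refl = inj₂ refl

≡⇒≼ : ∀ {a b} → a ≡ b → a ≼ b
≡⇒≼ = inj₂

𝟎≼ : ∀ a → 𝟎 ≼ a
𝟎≼ 𝟎          = inj₂ refl
𝟎≼ (ω^ _ + _) = inj₁ 𝟎≺

≺-≼-trans : ∀ {a b c} → a ≺ b → b ≼ c → a ≺ c
≺-≼-trans p (inj₁ q)    = ≺-trans p q
≺-≼-trans p (inj₂ refl) = p

≼-≺-trans : ∀ {a b c} → a ≼ b → b ≺ c → a ≺ c
≼-≺-trans (inj₁ p)    q = ≺-trans p q
≼-≺-trans (inj₂ refl) q = q

≼-trans : ∀ {a b c} → a ≼ b → b ≼ c → a ≼ c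
≼-trans (inj₁ p)    q = inj₁ (≺-≼-trans p q)
≼-trans (inj₂ refl) q = q

≼-≢ : ∀ {a b} → a ≼ b → a ≢ b → a ≺ b
≼-≢ (inj₁ p) _  = p
≼-≢ (inj₂ p) ne = ⊥-elim (ne p)

≼⊎≻ : ∀ a b → a ≼ b ⊎ b ≺ a
≼⊎≻ a b with cmp a b | cmp-correct a b
... | lt | is-lt p = inj₁ (inj₁ p)
... | eq | is-eq p = inj₁ (inj₂ p)
... | gt | is-gt p = inj₂ p

max : O → O → O
max a b with ≼⊎≻ a b
... | inj₁ _ = b
... | inj₂ _ = a

max-≥ˡ : ∀ a b → a ≼ max a b
max-≥ˡ a b with ≼⊎≻ a b
... | inj₁ p = p
... | inj₂ _ = ≼-refl

max-≥ʳ : ∀ a b → b ≼ max a b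
max-≥ʳ a b with ≼⊎≻ a b
... | inj₁ _ = ≼-refl
... | inj₂ p = inj₁ p

max-elim : ∀ {p} (P : O → Set p) a b → P a → P b → P (max a b)
max-elim P a b pa pb with ≼⊎≻ a b
... | inj₁ _ = pb
... | inj₂ _ = pa

-- Cantor normal forms and sums with a power of ω.

_≼ʰ_ : O → O → Set
𝟎          ≼ʰ a = ⊤
(ω^ c + _) ≼ʰ a = c ≼ a

CNF⁺ : ∀ {a} b → CNF a → CNF b → b ≼ʰ a → CNF (ω^ a + b)
CNF⁺ 𝟎          p _ _ = p
CNF⁺ (ω^ _ + _) p q r = p , q , ≼⇒≤ₒ r

CNF⁻ : ∀ {a} b → CNF (ω^ a + b) → CNF a × CNF b × b ≼ʰ a
CNF⁻ 𝟎          p = p , tt , tt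
CNF⁻ (ω^ _ + _) (p , q , r) = p , q , ≤ₒ⇒≼ r

ℓ-≤-head : ∀ a b → CNF (ω^ a + b) → ℓ (ω^ a + b) ≼ a
ℓ-≤-head a 𝟎          _           = ≼-refl
ℓ-≤-head a (ω^ c + d) (_ , q , r) = ≼-trans (ℓ-≤-head c d q) (≤ₒ⇒≼ r)

-- Positivity of `b` is phrased as `c ≺ b`, the form in which it arises below.
ℓ-tail : ∀ a {b c} → c ≺ b → ℓ (ω^ a + b) ≡ ℓ b
ℓ-tail a {ω^ _ + _} _ = refl

<-snoc : ∀ y δ → y ≺ (y ⊕ ωpow δ)
<-snoc 𝟎          δ = 𝟎≺
<-snoc (ω^ c + d) δ with cmp c δ | cmp-correct c δ
... | lt | is-lt p = head≺ p
... | eq | _       = tail≺ (<-snoc d δ)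
... | gt | _       = tail≺ (<-snoc d δ)

ℓ-snoc : ∀ y δ → ℓ (y ⊕ ωpow δ) ≡ δ
ℓ-snoc 𝟎          δ = refl
ℓ-snoc (ω^ c + d) δ with cmp c δ
... | lt = refl
... | eq = trans (ℓ-tail c (<-snoc d δ)) (ℓ-snoc d δ)
... | gt = trans (ℓ-tail c (<-snoc d δ)) (ℓ-snoc d δ)

snoc-≼ʰ : ∀ {a} d δ → d ≼ʰ a → δ ≼ a → (d ⊕ ωpow δ) ≼ʰ a
snoc-≼ʰ 𝟎          δ _ q = q
snoc-≼ʰ (ω^ c + d) δ p q with cmp c δ
... | lt = q
... | eq = p
... | gt = p

CNF-snoc : ∀ y δ → CNF y → CNF δ → CNF (y ⊕ ωpow δ)
CNF-snoc 𝟎          δ _ q = q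
CNF-snoc (ω^ c + d) δ p q with CNF⁻ d p | cmp c δ | cmp-correct c δ
... | _           | lt | _          = q
... | c! , d! , h | eq | is-eq refl = CNF⁺ (d ⊕ ωpow δ) c! (CNF-snoc d δ d! q) (snoc-≼ʰ d δ h ≼-refl)
... | c! , d! , h | gt | is-gt r    = CNF⁺ (d ⊕ ωpow δ) c! (CNF-snoc d δ d! q) (snoc-≼ʰ d δ h (inj₁ r))

ωpow-least : ∀ {a b δ} → δ ≼ a → ωpow δ ≼ (ω^ a + b)
ωpow-least             (inj₁ p)    = inj₁ ((head≺ p))
ωpow-least {b = 𝟎}     (inj₂ refl) = inj₂ refl
ωpow-least {b = ω^ _ + _} (inj₂ refl) = inj₁ ((tail≺ 𝟎≺))

tail-≼ : ∀ {a b d} → b ≼ d → (ω^ a + b) ≼ (ω^ a + d)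
tail-≼ (inj₁ p)    = inj₁ ((tail≺ p))
tail-≼ (inj₂ refl) = inj₂ refl

-- Compare leading terms, cancelling shared ones. Once ω^δ absorbs what is left of `y`, `x` is large
-- enough because in a normal form the leading exponent is at least `ℓ x`, hence at least `δ`.
snoc-least : ∀ {x} y δ → CNF x → y ≺ x → δ ≼ ℓ x → (y ⊕ ωpow δ) ≼ x
snoc-least {ω^ a + b} 𝟎 δ cx 𝟎≺ q = ωpow-least (≼-trans q (ℓ-≤-head a b cx))
snoc-least {ω^ a + b} (ω^ c + d) δ cx (head≺ p) q with cmp c δ
... | lt = ωpow-least (≼-trans q (ℓ-≤-head a b cx))
... | eq = inj₁ ((head≺ p))
... | gt = inj₁ ((head≺ p))
snoc-least {ω^ a + b} (ω^ .a + d) δ cx (tail≺ p) q with cmp a δ | cmp-correct a δ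
... | lt | is-lt r = ωpow-least (≼-trans q (ℓ-≤-head a b cx))
... | eq | _ = tail-≼ (snoc-least d δ (proj₁ (proj₂ (CNF⁻ b cx))) p (subst (δ ≼_) (ℓ-tail a p) q))
... | gt | _ = tail-≼ (snoc-least d δ (proj₁ (proj₂ (CNF⁻ b cx))) p (subst (δ ≼_) (ℓ-tail a p) q))

snoc-mono : ∀ {y} y′ δ δ′ → CNF y′ → CNF δ′ → y ≼ y′ → δ ≼ δ′ → (y ⊕ ωpow δ) ≼ (y′ ⊕ ωpow δ′)
snoc-mono {y} y′ δ δ′ cy cδ p q =
  snoc-least y δ (CNF-snoc y′ δ′ cy cδ) (≼-≺-trans p ((<-snoc y′ δ′)))
    (subst (δ ≼_) (sym (ℓ-snoc y′ δ′)) q)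

-- The non-strict counterpart of `y ⊕ ωpow δ`: the least ordinal from `y` on whose `ℓ` is at least
-- `δ`.
raise : O → O → O
raise y δ with ≼⊎≻ δ (ℓ y)
... | inj₁ _ = y
... | inj₂ _ = y ⊕ ωpow δ

raise-≥ : ∀ y δ → y ≼ raise y δ
raise-≥ y δ with ≼⊎≻ δ (ℓ y)
... | inj₁ _ = ≼-refl
... | inj₂ _ = inj₁ ((<-snoc y δ))

raise-ℓ : ∀ y δ → δ ≼ ℓ (raise y δ)
raise-ℓ y δ with ≼⊎≻ δ (ℓ y)
... | inj₁ p = p
... | inj₂ _ = inj₂ (sym (ℓ-snoc y δ))

CNF-raise : ∀ y δ → CNF y → CNF δ → CNF (raise y δ)
CNF-raise y δ cy cδ with ≼⊎≻ δ (ℓ y)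
... | inj₁ _ = cy
... | inj₂ _ = CNF-snoc y δ cy cδ

raise-least : ∀ {x} y δ → CNF x → y ≼ x → δ ≼ ℓ x → raise y δ ≼ x
raise-least y δ cx p q with ≼⊎≻ δ (ℓ y)
... | inj₁ _ = p
... | inj₂ r = snoc-least y δ cx (≼-≢ p λ { refl → ≺-irrefl (≺-≼-trans r q) }) q

-- In the second case equality would give `ℓ x ≡ δ`, against `δ ≺ ℓ x`.
raise-least-< : ∀ {x} y δ → CNF x → y ≺ x → δ ≺ ℓ x → raise y δ ≺ x
raise-least-< y δ cx p q with ≼⊎≻ δ (ℓ y)
... | inj₁ _ = p
... | inj₂ r = ≼-≢ (snoc-least y δ cx p (inj₁ q))
                 λ { refl → ≺-irrefl (subst (δ ≺_) (ℓ-snoc y δ) q) }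

-- Descent from a coordinate beyond which everything is trivial. Shifting `P` avoids subtraction of
-- indices.
down : ∀ {p} (P : ℕ → Set p) N → (∀ i → N ≤ℕ i → P i) → (∀ i → P (suc i) → P i) → ∀ i → P i
down P zero    base step i       = base i z≤n
down P (suc N) base step zero    =
  step 0 (down (P ∘ suc) N (λ i p → base (suc i) (s≤s p)) (λ i → step (suc i)) 0)
down P (suc N) base step (suc i) =
  down (P ∘ suc) N (λ i p → base (suc i) (s≤s p)) (λ i → step (suc i)) i

-- Elements and operations of the Ignatiev algebra.

∇I-≤ : ∀ {n i} α → i ≤ℕ n → ∇I n α i ≡ α i
∇I-≤ {n} {i} α p rewrite dec-true (i ≤? n) p = refl

∇I-> : ∀ {n i} α → n <ℕ i → ∇I n α i ≡ 𝟎
∇I-> {n} {i} α p rewrite dec-false (i ≤? n) (ℕₚ.<⇒≱ p) = refl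

◇I-> : ∀ {n i} α → n <ℕ i → ◇I n α i ≡ 𝟎
◇I-> {n} {i} α p rewrite dec-false (i ≤? n) (ℕₚ.<⇒≱ p) = refl

-- Turns the step count of `◇aux` into a recursion from coordinate `suc i` to `i`; at `i = n` the
-- next coordinate is `𝟎`, the exponent in the base case.
◇I-≤ : ∀ {n i} α → i ≤ℕ n → ◇I n α i ≡ α i ⊕ ωpow (◇I n α (suc i))
◇I-≤ {n} {i} α p with ℕₚ.m≤n⇒m<n∨m≡n p
... | inj₂ refl rewrite dec-true (i ≤? i) p | dec-false (suc i ≤? i) ℕₚ.1+n≰n | ℕₚ.n∸n≡0 i = refl
... | inj₁ q@(s≤s r) rewrite dec-true (i ≤? n) p | dec-true (suc i ≤? n) q | ℕₚ.+-∸-assoc 1 r = refl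

◇I-≺ : ∀ {n i} α → i ≤ℕ n → α i ≺ ◇I n α i
◇I-≺ {n} {i} α p rewrite ◇I-≤ α p = (<-snoc (α i) _)

InS : Seq → Set
InS α = (∀ i → CNF (α i)) × (∀ i → α (suc i) ≼ ℓ (α i))

_⊑_ : Seq → Seq → Set
α ⊑ β = ∀ i → β i ≼ α i

-- The explicit `bound` lets meets be computed by finite descent.
record Elt : Set where
  constructor elt
  field
    seq    : Seq
    inS    : InS seq
    bound  : ℕ
    vanish : ∀ i → bound ≤ℕ i → seq i ≡ 𝟎
open Elt

⊑-refl : ∀ {α} → α ⊑ α
⊑-refl i = ≼-refl

⊑-trans : ∀ {α β γ} → α ⊑ β → β ⊑ γ → α ⊑ γ
⊑-trans p q i = ≼-trans (q i) (p i)

CNF-◇I : ∀ n {α} → (∀ i → CNF (α i)) → ∀ i → CNF (◇I n α i)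
CNF-◇I n {α} c = down _ (suc n) (λ i p → subst CNF (sym (◇I-> α p)) tt) step
  where
  step : ∀ i → CNF (◇I n α (suc i)) → CNF (◇I n α i)
  step i ih with i ≤? n
  ... | yes p = subst CNF (sym (◇I-≤ α p)) (CNF-snoc (α i) _ (c i) ih)
  ... | no  p = subst CNF (sym (◇I-> α (≰⇒> p))) tt

InS-◇I : ∀ n {α} → InS α → InS (◇I n α)
InS-◇I n {α} (c , _) = CNF-◇I n c , step
  where
  step : ∀ i → ◇I n α (suc i) ≼ ℓ (◇I n α i)
  step i with i ≤? n
  ... | yes p rewrite ◇I-≤ α p = inj₂ (sym (ℓ-snoc (α i) _))
  ... | no  p rewrite ◇I-> α (ℕₚ.m<n⇒m<1+n (≰⇒> p)) = 𝟎≼ _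

InS-∇I : ∀ n {α} → InS α → InS (∇I n α)
InS-∇I n {α} (c , h) = cnf , step
  where
  cnf : ∀ i → CNF (∇I n α i)
  cnf i with i ≤? n
  ... | yes p = subst CNF (sym (∇I-≤ α p)) (c i)
  ... | no  p = subst CNF (sym (∇I-> α (≰⇒> p))) tt
  step : ∀ i → ∇I n α (suc i) ≼ ℓ (∇I n α i)
  step i with suc i ≤? n
  ... | yes p rewrite ∇I-≤ α p | ∇I-≤ α (ℕₚ.<⇒≤ p) = h i
  ... | no  p rewrite ∇I-> α (≰⇒> p) = 𝟎≼ _

⊤E : Elt
⊤E = elt zeroSeq ((λ _ → tt) , λ _ → ≼-refl) 0 (λ _ _ → refl)

◇E ∇E : ℕ → Elt → Elt
◇E n x = elt (◇I n (seq x)) (InS-◇I n (inS x)) (suc n) (λ _ → ◇I-> (seq x))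
∇E n x = elt (∇I n (seq x)) (InS-∇I n (inS x)) (suc n) (λ _ → ∇I-> (seq x))

-- Meets.

meetSeq : ℕ → Seq → Seq → Seq
meetSeq zero    α β i       = 𝟎
meetSeq (suc N) α β zero    = raise (max (α 0) (β 0)) (meetSeq N (α ∘ suc) (β ∘ suc) 0)
meetSeq (suc N) α β (suc i) = meetSeq N (α ∘ suc) (β ∘ suc) i

meetSeq-vanish : ∀ N α β i → N ≤ℕ i → meetSeq N α β i ≡ 𝟎
meetSeq-vanish zero    α β i       _       = refl
meetSeq-vanish (suc N) α β (suc i) (s≤s p) = meetSeq-vanish N (α ∘ suc) (β ∘ suc) i p

meetSeq-eq : ∀ N α β → (∀ i → N ≤ℕ i → α i ≡ 𝟎) → (∀ i → N ≤ℕ i → β i ≡ 𝟎) →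
  ∀ i → meetSeq N α β i ≡ raise (max (α i) (β i)) (meetSeq N α β (suc i))
meetSeq-eq zero    α β p q i rewrite p i z≤n | q i z≤n = refl
meetSeq-eq (suc N) α β p q zero    = refl
meetSeq-eq (suc N) α β p q (suc i) =
  meetSeq-eq N (α ∘ suc) (β ∘ suc) (λ i r → p (suc i) (s≤s r)) (λ i r → q (suc i) (s≤s r)) i

module _ (x y : Elt) where
  private
    α = seq x
    β = seq y
    N = bound x ⊔ bound y

  μ : Seq
  μ = meetSeq N α β

  μ-eq : ∀ i → μ i ≡ raise (max (α i) (β i)) (μ (suc i))
  μ-eq = meetSeq-eq N α β
    (λ i p → vanish x i (ℕₚ.≤-trans (ℕₚ.m≤m⊔n _ _) p))
    (λ i p → vanish y i (ℕₚ.≤-trans (ℕₚ.m≤n⊔m (bound x) _) p))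

  μ-InS : InS μ
  μ-InS = down _ N (λ i p → subst CNF (sym (meetSeq-vanish N α β i p)) tt)
            (λ i c → subst CNF (sym (μ-eq i))
              (CNF-raise _ (μ (suc i)) (max-elim CNF (α i) (β i) (proj₁ (inS x) i) (proj₁ (inS y) i)) c))
        , λ i → subst (λ z → μ (suc i) ≼ ℓ z) (sym (μ-eq i)) (raise-ℓ _ (μ (suc i)))

  _⊓_ : Elt
  _⊓_ = elt μ μ-InS N (meetSeq-vanish N α β)

  ⊓-≤ˡ : μ ⊑ α
  ⊓-≤ˡ i rewrite μ-eq i = ≼-trans (max-≥ˡ (α i) (β i)) (raise-≥ _ (μ (suc i)))

  ⊓-≤ʳ : μ ⊑ β
  ⊓-≤ʳ i rewrite μ-eq i = ≼-trans (max-≥ʳ (α i) (β i)) (raise-≥ _ (μ (suc i)))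

  ⊓-step : ∀ {c i} → CNF c → α i ≼ c → β i ≼ c → μ (suc i) ≼ ℓ c → μ i ≼ c
  ⊓-step {c} {i} cc p q r rewrite μ-eq i =
    raise-least _ (μ (suc i)) cc (max-elim (_≼ c) (α i) (β i) p q) r

  ⊓-step-< : ∀ {c i} → CNF c → α i ≺ c → β i ≺ c → μ (suc i) ≺ ℓ c → μ i ≺ c
  ⊓-step-< {c} {i} cc p q r rewrite μ-eq i =
    raise-least-< _ (μ (suc i)) cc (max-elim (_≺ c) (α i) (β i) p q) r

  -- Coordinate `i` of the meet depends only on coordinates from `i` on, so the comparison may start
  -- at any `k`; `⊓-local` starts it above `m`.
  ⊓-above : ∀ {γ k} → InS γ → (∀ i → k ≤ℕ i → α i ≼ γ i) → (∀ i → k ≤ℕ i → β i ≼ γ i) →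
    ∀ i → k ≤ℕ i → μ i ≼ γ i
  ⊓-above {γ} (c , h) p q = down _ N
    (λ i r _ → subst (_≼ γ i) (sym (meetSeq-vanish N α β i r)) (𝟎≼ _))
    (λ i ih k≤i → ⊓-step (c i) (p i k≤i) (q i k≤i) (≼-trans (ih (ℕₚ.m≤n⇒m≤1+n k≤i)) (h i)))

  ⊓-greatest : ∀ {γ} → InS γ → γ ⊑ α → γ ⊑ β → γ ⊑ μ
  ⊓-greatest γI p q i = ⊓-above {k = 0} γI (λ i _ → p i) (λ i _ → q i) i z≤n

-- Validity of the axioms in the algebra.

◇I-⊑-∇I : ∀ n α → ◇I n α ⊑ ∇I n α
◇I-⊑-∇I n α i with i ≤? n
... | yes p rewrite ∇I-≤ α p = inj₁ (◇I-≺ α p)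
... | no  p rewrite ∇I-> α (≰⇒> p) = 𝟎≼ _

∇I-mono : ∀ n {α β} → α ⊑ β → ∇I n α ⊑ ∇I n β
∇I-mono n {α} {β} h i with i ≤? n
... | yes p rewrite ∇I-≤ α p | ∇I-≤ β p = h i
... | no  p rewrite ∇I-> β (≰⇒> p) = 𝟎≼ _

⊑-∇I : ∀ n α → α ⊑ ∇I n α
⊑-∇I n α i with i ≤? n
... | yes p rewrite ∇I-≤ α p = ≼-refl
... | no  p rewrite ∇I-> α (≰⇒> p) = 𝟎≼ _

∇I-antitone : ∀ {m n} → m ≤ℕ n → ∀ α → ∇I n α ⊑ ∇I m α
∇I-antitone {m} {n} m≤n α i with i ≤? m
... | yes p rewrite ∇I-≤ α p | ∇I-≤ α (ℕₚ.≤-trans p m≤n) = ≼-refl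
... | no  p rewrite ∇I-> α (≰⇒> p) = 𝟎≼ _

∇I-idem : ∀ n α → ∇I n (∇I n α) ⊑ ∇I n α
∇I-idem n α i with i ≤? n
... | yes p rewrite ∇I-≤ (∇I n α) p = ≼-refl
... | no  p rewrite ∇I-> α (≰⇒> p) = 𝟎≼ _

-- Two indices, and a hypothesis only up to `m`, let one descent cover monotonicity, transitivity,
-- `◇mono` and `◇∇◇`.
◇I-mono′ : ∀ {m n α β} → m ≤ℕ n → (∀ i → CNF (α i)) → (∀ i → i ≤ℕ m → β i ≼ α i) → ◇I n α ⊑ ◇I m β
◇I-mono′ {m} {n} {α} {β} m≤n c h =
  down _ (suc m) (λ i p → subst (_≼ ◇I n α i) (sym (◇I-> β p)) (𝟎≼ _)) step
  where
  step : ∀ i → ◇I m β (suc i) ≼ ◇I n α (suc i) → ◇I m β i ≼ ◇I n α i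
  step i ih with i ≤? m
  ... | yes p rewrite ◇I-≤ β p | ◇I-≤ α (ℕₚ.≤-trans p m≤n) =
        snoc-mono (α i) _ _ (c i) (CNF-◇I n c (suc i)) (h i p) ih
  ... | no  p rewrite ◇I-> β (≰⇒> p) = 𝟎≼ _

◇I-mono : ∀ n {α β} → (∀ i → CNF (α i)) → α ⊑ β → ◇I n α ⊑ ◇I n β
◇I-mono n c h = ◇I-mono′ ℕₚ.≤-refl c (λ i _ → h i)

◇I-trans : ∀ n {α} → (∀ i → CNF (α i)) → ◇I n (◇I n α) ⊑ ◇I n α
◇I-trans n {α} c = ◇I-mono′ ℕₚ.≤-refl (CNF-◇I n c) (λ i p → inj₁ (◇I-≺ α p))

◇I-∇I : ∀ {m n α} → m ≤ℕ n → (∀ i → CNF (∇I n α i)) → ◇I m (∇I n α) ⊑ ◇I m α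
◇I-∇I {m} {n} {α} m≤n c = ◇I-mono′ ℕₚ.≤-refl c (λ i p → inj₂ (sym (∇I-≤ α (ℕₚ.≤-trans p m≤n))))

∇I-◇I : ∀ {m n} α → m ≤ℕ n → ∇I n (◇I m α) ⊑ ◇I m α
∇I-◇I {m} {n} α m≤n i with i ≤? m
... | yes p rewrite ∇I-≤ (◇I m α) (ℕₚ.≤-trans p m≤n) = ≼-refl
... | no  p rewrite ◇I-> α (≰⇒> p) = 𝟎≼ _

⊓-local : ∀ {m} x y → (∀ i → m <ℕ i → seq y i ≡ 𝟎) → ∀ i → m <ℕ i → seq (x ⊓ y) i ≼ seq x i
⊓-local x y z = ⊓-above x y (inS x) (λ _ _ → ≼-refl)
  (λ i p → subst (_≼ seq x i) (sym (z i p)) (𝟎≼ _))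

-- Above `m` the coordinates of `x ⊓ ∇E m y` do not exceed those of `x`. From `m` down `⊓-step`
-- applies, because the left side is in the algebra and its coordinates bound those of both
-- arguments.
∇I-J : ∀ {m n} → m <ℕ n → ∀ x y → seq (∇E n x ⊓ ∇E m y) ⊑ seq (∇E n (x ⊓ ∇E m y))
∇I-J {m} {n} m<n x y = bounded
  where
  z = ∇E n x ⊓ ∇E m y
  γ = seq z
  ν = seq (x ⊓ ∇E m y)
  γ≥x : ∀ i → i ≤ℕ n → seq x i ≼ γ i
  γ≥x i p = subst (_≼ γ i) (∇I-≤ (seq x) p) (⊓-≤ˡ (∇E n x) (∇E m y) i)
  high : ∀ i → m <ℕ i → i ≤ℕ n → ν i ≼ γ i
  high i p q = ≼-trans (⊓-local x (∇E m y) (λ _ → ∇I-> (seq y)) i p) (γ≥x i q)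
  step : ∀ i → (suc i ≤ℕ n → ν (suc i) ≼ γ (suc i)) → i ≤ℕ n → ν i ≼ γ i
  step i ih q with i ≤? m
  ... | no  p = high i (≰⇒> p) q
  ... | yes p = ⊓-step x (∇E m y) (proj₁ (inS z) i) (γ≥x i q) (⊓-≤ʳ (∇E n x) (∇E m y) i)
                  (≼-trans (ih (ℕₚ.≤-trans (s≤s p) m<n)) (proj₂ (inS z) i))
  low : ∀ i → i ≤ℕ n → ν i ≼ γ i
  low = down _ (suc m) high step
  bounded : γ ⊑ ∇I n ν
  bounded i with i ≤? n
  ... | yes p rewrite ∇I-≤ ν p = low i p
  ... | no  p rewrite ∇I-> ν (≰⇒> p) = 𝟎≼ _

-- The left side strictly exceeds x ⊓ ◇E m y in all coordinates up to n, by descent from m + 1: if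
-- coordinate i of the left side were equal to that of ◇E m y, their ℓ would agree, contradicting
-- strictness at i + 1.
◇I-J : ∀ {m n} → m <ℕ n → ∀ x y → seq (◇E n x ⊓ ◇E m y) ⊑ seq (◇E n (x ⊓ ◇E m y))
◇I-J {m} {n} m<n x y = down _ (suc n) (λ i p → subst (_≼ γ i) (sym (◇I-> ν p)) (𝟎≼ _)) step
  where
  z = ◇E n x ⊓ ◇E m y
  γ = seq z
  ν = seq (x ⊓ ◇E m y)
  γ>x : ∀ i → i ≤ℕ n → seq x i ≺ γ i
  γ>x i p = ≺-≼-trans (◇I-≺ (seq x) p) (⊓-≤ˡ (◇E n x) (◇E m y) i)
  high : ∀ i → m <ℕ i → i ≤ℕ n → ν i ≺ γ i
  high i p q = ≼-≺-trans (⊓-local x (◇E m y) (λ _ → ◇I-> (seq y)) i p) (γ>x i q)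
  strict-step : ∀ i → (suc i ≤ℕ n → ν (suc i) ≺ γ (suc i)) → i ≤ℕ n → ν i ≺ γ i
  strict-step i ih q with i ≤? m
  ... | no  p = high i (≰⇒> p) q
  ... | yes p = ⊓-step-< x (◇E m y) (proj₁ (inS z) i) (γ>x i q)
                  (≼-≢ (⊓-≤ʳ (◇E n x) (◇E m y) i) distinct) ν<ℓγ
    where
    ν<ℓγ : ν (suc i) ≺ ℓ (γ i)
    ν<ℓγ = ≺-≼-trans (ih (ℕₚ.≤-trans (s≤s p) m<n)) (proj₂ (inS z) i)
    ℓ◇ : ℓ (◇I m (seq y) i) ≡ ◇I m (seq y) (suc i)
    ℓ◇ = trans (cong ℓ (◇I-≤ (seq y) p)) (ℓ-snoc (seq y i) _)
    distinct : ◇I m (seq y) i ≢ γ i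
    distinct e = ≺-irrefl (≺-≼-trans ν<ℓγ
      (≼-trans (≡⇒≼ (trans (cong ℓ (sym e)) ℓ◇)) (⊓-≤ʳ x (◇E m y) (suc i))))
  strict : ∀ i → i ≤ℕ n → ν i ≺ γ i
  strict = down _ (suc m) high strict-step
  step : ∀ i → ◇I n ν (suc i) ≼ γ (suc i) → ◇I n ν i ≼ γ i
  step i ih with i ≤? n
  ... | yes p rewrite ◇I-≤ ν p =
        snoc-least (ν i) _ (proj₁ (inS z) i) (strict i p) (≼-trans ih (proj₂ (inS z) i))
  ... | no  p rewrite ◇I-> ν (≰⇒> p) = 𝟎≼ _

-- Evaluation and soundness.

⟦_⟧ : Fm → (ℕ → Elt) → Elt
⟦ var x ⟧  v = v x
⟦ ⊤' ⟧     v = ⊤E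
⟦ A ∧' B ⟧ v = ⟦ A ⟧ v ⊓ ⟦ B ⟧ v
⟦ ◇ n A ⟧  v = ◇E n (⟦ A ⟧ v)
⟦ ∇ n A ⟧  v = ∇E n (⟦ A ⟧ v)

-- A derivation between variable-free formulas may pass through variables, so soundness ranges over
-- all valuations, and the substitution rule becomes a change of valuation.
⟦⟧-sub : ∀ σ A v → ⟦ sub σ A ⟧ v ≡ ⟦ A ⟧ (λ x → ⟦ σ x ⟧ v)
⟦⟧-sub σ (var x)  v = refl
⟦⟧-sub σ ⊤'       v = refl
⟦⟧-sub σ (A ∧' B) v = cong₂ _⊓_ (⟦⟧-sub σ A v) (⟦⟧-sub σ B v)
⟦⟧-sub σ (◇ n A)  v = cong (◇E n) (⟦⟧-sub σ A v)
⟦⟧-sub σ (∇ n A)  v = cong (∇E n) (⟦⟧-sub σ A v)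

sound : ∀ {A B} → A ⊢ B → ∀ v → seq (⟦ A ⟧ v) ⊑ seq (⟦ B ⟧ v)
sound refl⊢ v = ⊑-refl
sound top v i = 𝟎≼ _
sound (∧E₁ {A} {B}) v = ⊓-≤ˡ (⟦ A ⟧ v) (⟦ B ⟧ v)
sound (∧E₂ {A} {B}) v = ⊓-≤ʳ (⟦ A ⟧ v) (⟦ B ⟧ v)
sound (cut p q) v = ⊑-trans (sound p v) (sound q v)
sound (∧I {A} {B} {C} p q) v = ⊓-greatest (⟦ B ⟧ v) (⟦ C ⟧ v) (inS (⟦ A ⟧ v)) (sound p v) (sound q v)
sound (mono {A} (dia n) p) v = ◇I-mono n (proj₁ (inS (⟦ A ⟧ v))) (sound p v)
sound (mono (nab n) p) v = ∇I-mono n (sound p v)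
sound (trans4 {A} (dia n)) v = ◇I-trans n (proj₁ (inS (⟦ A ⟧ v)))
sound (trans4 {A} (nab n)) v = ∇I-idem n (seq (⟦ A ⟧ v))
sound (◇mono {A = A} m<n) v = ◇I-mono′ (ℕₚ.<⇒≤ m<n) (proj₁ (inS (⟦ A ⟧ v))) (λ _ _ → ≼-refl)
sound (◇J {A = A} {B} m<n) v = ◇I-J m<n (⟦ A ⟧ v) (⟦ B ⟧ v)
sound (∇mono {A = A} m<n) v = ∇I-antitone (ℕₚ.<⇒≤ m<n) (seq (⟦ A ⟧ v))
sound (∇J {A = A} {B} m<n) v = ∇I-J m<n (⟦ A ⟧ v) (⟦ B ⟧ v)
sound (∇T {n} {A}) v = ⊑-∇I n (seq (⟦ A ⟧ v))
sound (◇∇ {n} {A}) v = ◇I-⊑-∇I n (seq (⟦ A ⟧ v))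
sound (◇∇◇ {n = n} {A} m≤n) v = ◇I-∇I m≤n (proj₁ (inS (∇E n (⟦ A ⟧ v))))
sound (∇◇◇ {A = A} m≤n) v = ∇I-◇I (seq (⟦ A ⟧ v)) m≤n
sound (subst⊢ {A} {B} σ p) v rewrite ⟦⟧-sub σ A v | ⟦⟧-sub σ B v = sound p _

-- Agreement of `Val` with the evaluation.

InS⇒InI : ∀ α → InS α → InI α
InS⇒InI α (c , h) = c , ≼⇒≤ₒ ∘ h

InI⇒InS : ∀ α → InI α → InS α
InI⇒InS α (c , h) = c , ≤ₒ⇒≼ ∘ h

⊓-isMeet : ∀ x y → IsMeet (seq x) (seq y) (seq (x ⊓ y))
⊓-isMeet x y = InS⇒InI (seq (x ⊓ y)) (inS (x ⊓ y)) , ≼⇒≤ₒ ∘ ⊓-≤ˡ x y , ≼⇒≤ₒ ∘ ⊓-≤ʳ x y ,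
  λ γ γI p q → ≼⇒≤ₒ ∘ ⊓-greatest x y (InI⇒InS γ γI) (≤ₒ⇒≼ ∘ p) (≤ₒ⇒≼ ∘ q)

Val-⟦⟧ : ∀ {A} → VarFree A → ∀ v → Val A (seq (⟦ A ⟧ v))
Val-⟦⟧ ⊤'       v = v⊤
Val-⟦⟧ {A ∧' B} (a ∧' b) v = v∧ (Val-⟦⟧ a v) (Val-⟦⟧ b v) (⊓-isMeet (⟦ A ⟧ v) (⟦ B ⟧ v))
Val-⟦⟧ (◇ a)    v = v◇ (Val-⟦⟧ a v)
Val-⟦⟧ (∇ a)    v = v∇ (Val-⟦⟧ a v)

-- Two inequalities replace an equation because `IsMeet` determines a sequence only coordinatewise.
Val-unique : ∀ {A α} → Val A α → ∀ v → InS α × α ⊑ seq (⟦ A ⟧ v) × seq (⟦ A ⟧ v) ⊑ α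
Val-unique v⊤ v = inS ⊤E , ⊑-refl , ⊑-refl
Val-unique (v∧ {A} {B} {m = m} a b (mI , m≤α , m≤β , greatest)) v with Val-unique a v | Val-unique b v
... | _ , α⊑ , ⊑α | _ , β⊑ , ⊑β =
  InI⇒InS m mI ,
  ⊓-greatest (⟦ A ⟧ v) (⟦ B ⟧ v) (InI⇒InS m mI)
    (⊑-trans (≤ₒ⇒≼ ∘ m≤α) α⊑) (⊑-trans (≤ₒ⇒≼ ∘ m≤β) β⊑) ,
  ≤ₒ⇒≼ ∘ greatest _ (InS⇒InI (seq w) (inS w))
    (≼⇒≤ₒ ∘ ⊑-trans (⊓-≤ˡ (⟦ A ⟧ v) (⟦ B ⟧ v)) ⊑α)
    (≼⇒≤ₒ ∘ ⊑-trans (⊓-≤ʳ (⟦ A ⟧ v) (⟦ B ⟧ v)) ⊑β)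
  where w = ⟦ A ⟧ v ⊓ ⟦ B ⟧ v
Val-unique (v◇ {n} {A} a) v with Val-unique a v
... | αI , α⊑ , ⊑α = InS-◇I n αI , ◇I-mono n (proj₁ αI) α⊑ , ◇I-mono n (proj₁ (inS (⟦ A ⟧ v))) ⊑α
Val-unique (v∇ {n} a) v with Val-unique a v
... | αI , α⊑ , ⊑α = InS-∇I n αI , ∇I-mono n α⊑ , ∇I-mono n ⊑α

-- Worms and their order.

-- The worm of α on top of X; the recursion is on the leading term, so X accumulates the smaller
-- worms built from the terms already read.
wormOn : ℕ → O → Fm → Fm
wormOn i 𝟎          X = X
wormOn i (ω^ a + b) X = wormOn i b (wormOn (suc i) a ⊤' ∧' ◇ i X)

worm : ℕ → O → Fm
worm i α = wormOn i α ⊤'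

wormOn-◇ : ∀ i a b X → wormOn i (ω^ a + b) X ⊢ ◇ i X
wormOn-◇ i a 𝟎          X = ∧E₂
wormOn-◇ i a (ω^ c + d) X =
  cut (wormOn-◇ i c d _) (cut (mono (dia i) ∧E₂) (trans4 (dia i)))

mutual
  -- Common leading terms move into `X`. At the first difference `β` either ends or has the smaller
  -- exponent; then `absorb` rebuilds the rest of `β` from that one term of `α`, and later terms of
  -- `α` only add outer `◇ i`. Comparing the exponents is this lemma one level up, whence the mutual
  -- recursion.
  wormOn-≻ : ∀ i α β X → CNF β → β ≺ α → wormOn i α X ⊢ ◇ i (wormOn i β X)
  wormOn-≻ i (ω^ a + b) 𝟎 X _ 𝟎≺ = wormOn-◇ i a b X
  wormOn-≻ i (ω^ a + b) (ω^ .a + d) X cβ (tail≺ p) =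
    wormOn-≻ i b d _ (proj₁ (proj₂ (CNF⁻ d cβ))) p
  wormOn-≻ i (ω^ a + b) (ω^ c + d) X cβ (head≺ p) = finish b
    where
    leading : worm (suc i) a ∧' ◇ i X ⊢ ◇ i (wormOn i (ω^ c + d) X)
    leading = absorb i a (ω^ c + d) X cβ (_ , p , inj₂ refl) ∧E₁ ∧E₂
    finish : ∀ b → wormOn i b (worm (suc i) a ∧' ◇ i X) ⊢ ◇ i (wormOn i (ω^ c + d) X)
    finish 𝟎          = leading
    finish (ω^ e + f) = cut (wormOn-◇ i e f _) (cut (mono (dia i) leading) (trans4 (dia i)))

  -- Every exponent of β is below a, so the terms of β can be prefixed one at a time by axiom J.
  absorb : ∀ {Γ} i a β X → CNF β → (∃[ c ] (c ≺ a × β ≼ʰ c)) →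
    Γ ⊢ worm (suc i) a → Γ ⊢ ◇ i X → Γ ⊢ ◇ i (wormOn i β X)
  absorb i a 𝟎          X cβ _             p q = q
  absorb i a (ω^ c + d) X cβ (_ , e , c≼e) p q =
    absorb i a d _ (proj₁ (proj₂ cβ′)) (c , c≺a , proj₂ (proj₂ cβ′)) p
      (cut (∧I (cut p (wormOn-≻ (suc i) a c ⊤' (proj₁ cβ′) c≺a)) q)
        (cut (◇J ℕₚ.≤-refl) (◇mono ℕₚ.≤-refl)))
    where
    cβ′ = CNF⁻ d cβ
    c≺a = ≼-≺-trans c≼e e

-- The `∇ i` hides coordinate `suc i`, where `β` may be the larger one since `ℓ` is not monotone.
worm-≽ : ∀ i {α β} → CNF β → β ≼ α → ∇ i (worm i α) ⊢ ∇ i (worm i β)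
worm-≽ i cβ (inj₂ refl) = refl⊢
worm-≽ i cβ (inj₁ p) =
  cut (mono (nab i) (cut (wormOn-≻ i _ _ ⊤' cβ p) ◇∇)) (trans4 (nab i))

worm-ℓ : ∀ i α → worm i α ⊢ worm (suc i) (ℓ α)
worm-ℓ i α = go α ⊤'
  where
  go : ∀ α X → wormOn i α X ⊢ worm (suc i) (ℓ α)
  go 𝟎                       X = top
  go (ω^ a + 𝟎)              X = ∧E₁
  go (ω^ a + b@(ω^ _ + _))   X = go b _

worm-snoc : ∀ {Γ} i y δ X → Γ ⊢ worm (suc i) δ → Γ ⊢ ◇ i (wormOn i y X) → Γ ⊢ wormOn i (y ⊕ ωpow δ) X
worm-snoc i 𝟎          δ X p q = ∧I p q
worm-snoc i (ω^ a + b) δ X p q with cmp a δ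
-- ω^δ absorbs `a` and all later terms, so only the `◇ i X` beneath their layers is kept.
... | lt = ∧I p (cut q (cut (mono (dia i) (wormOn-◇ i a b X)) (trans4 (dia i))))
... | eq = worm-snoc i b δ _ p q
... | gt = worm-snoc i b δ _ p q

-- Normal forms.

module Collect (M : ℕ → Fm → Fm) (J : ∀ {m n A B} → m <ℕ n → M n A ∧' M m B ⊢ M n (A ∧' M m B)) where

  -- Each use of J brings one formula of lower index under `M n`; `k` counts those already moved.
  -- The result is a single context `Δ` in which one can argue under the modality.
  collect : ∀ {Γ n X} (Y : ℕ → Fm) k → k ≤ℕ n → Γ ⊢ M n X → (∀ i → i <ℕ n → Γ ⊢ M i (Y i)) →
    ∃[ Δ ] (Γ ⊢ M n Δ × Δ ⊢ X × (∀ i → i <ℕ k → Δ ⊢ M i (Y i)))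
  collect Y zero    _   p q = _ , p , refl⊢ , λ _ ()
  collect Y (suc k) k<n p q with collect Y k (ℕₚ.<⇒≤ k<n) p q
  ... | Δ , Γ⊢MΔ , Δ⊢X , Δ⊢Y = Δ ∧' M k (Y k) , cut (∧I Γ⊢MΔ (q k k<n)) (J k<n) , cut ∧E₁ Δ⊢X , last
    where
    last : ∀ i → i <ℕ suc k → Δ ∧' M k (Y k) ⊢ M i (Y i)
    last i (s≤s i≤k) with ℕₚ.m≤n⇒m<n∨m≡n i≤k
    ... | inj₁ i<k  = cut ∧E₁ (Δ⊢Y i i<k)
    ... | inj₂ refl = ∧E₂

-- Γ proves the (infinite) normal form of α.
Describes : Fm → Seq → Set
Describes Γ α = ∀ i → Γ ⊢ ∇ i (worm i (α i))

describes-𝟎 : ∀ {Γ i a} → a ≡ 𝟎 → Γ ⊢ ∇ i (worm i a)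
describes-𝟎 refl = cut top ∇T

-- If ℓ(y) < δ, then y ⊕ ωpow δ drops the terms of y below ω^δ.  For y ≠ 𝟎 there is at least one, and
-- dropping it turns the worm of y into ◇ i of a shorter one, which loses its ∇ i by ∇◇◇ and is then
-- moved under ∇ (suc i) by ∇J; for y = 𝟎 the formula ◇ i ⊤' comes from the worm of δ > 𝟎.
raise-∇ : ∀ {Γ} i y δ → Γ ⊢ ∇ i (worm i y) → Γ ⊢ ∇ (suc i) (worm (suc i) δ) →
  Γ ⊢ ∇ i (worm i (raise y δ))
raise-∇ {Γ} i y δ p q with ≼⊎≻ δ (ℓ y)
... | inj₁ _ = p
... | inj₂ r = start y δ r p q
  where
  finish : ∀ δ X → Γ ⊢ ◇ i X → Γ ⊢ ∇ (suc i) (worm (suc i) δ) → Γ ⊢ ∇ i (worm (suc i) δ ∧' ◇ i X)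
  finish δ X p q = cut (∧I q (cut p ∇T))
    (cut (∇J ℕₚ.≤-refl) (cut (∇mono ℕₚ.≤-refl) (mono (nab i) (∧I ∧E₁ (cut ∧E₂ (∇◇◇ ℕₚ.≤-refl))))))
  nonzero : ∀ a b δ X → ℓ (ω^ a + b) ≺ δ → Γ ⊢ ∇ i (wormOn i (ω^ a + b) X) →
    Γ ⊢ ∇ (suc i) (worm (suc i) δ) → Γ ⊢ ∇ i (wormOn i ((ω^ a + b) ⊕ ωpow δ) X)
  nonzero a b δ X r p q with cmp a δ | cmp-correct a δ
  nonzero a b δ X r p q | lt | _ =
    finish δ X (cut p (cut (mono (nab i) (wormOn-◇ i a b X)) (∇◇◇ ℕₚ.≤-refl))) q
  -- If the last term of `y` were kept, its exponent would be at least `δ`, against `ℓ y ≺ δ`.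
  nonzero a 𝟎          δ X r p q | eq | is-eq refl = ⊥-elim (≺-irrefl r)
  nonzero a 𝟎          δ X r p q | gt | is-gt s    = ⊥-elim (≺-irrefl (≺-trans r s))
  nonzero a (ω^ c + d) δ X r p q | eq | _ = nonzero c d δ _ r p q
  nonzero a (ω^ c + d) δ X r p q | gt | _ = nonzero c d δ _ r p q
  start : ∀ y δ → ℓ y ≺ δ → Γ ⊢ ∇ i (worm i y) → Γ ⊢ ∇ (suc i) (worm (suc i) δ) →
    Γ ⊢ ∇ i (worm i (y ⊕ ωpow δ))
  start (ω^ a + b) δ r p q = nonzero a b δ ⊤' r p q
  start 𝟎 δ@(ω^ e + f) r p q = finish δ ⊤'
    (cut q (cut (mono (nab (suc i)) (wormOn-◇ (suc i) e f ⊤')) (cut (∇◇◇ ℕₚ.≤-refl) (◇mono ℕₚ.≤-refl)))) q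

-- Inside ∇ n the worm of coordinate n gives coordinate n + 1, because x_{n+1} ≤ ℓ(x_n); repeat with
-- n + 1 until all nonzero coordinates are reached (k bounds the number of steps left).
∇-extend : ∀ {A} x → (∀ {Δ} → Describes Δ (seq x) → Δ ⊢ A) →
  ∀ k {Γ} n → bound x ≤ℕ k + n → (∀ i → i ≤ℕ n → Γ ⊢ ∇ i (worm i (seq x i))) → Γ ⊢ ∇ n A
∇-extend {A} x h k n b p 
  with Collect.collect ∇ ∇J (λ i → worm i (seq x i)) n ℕₚ.≤-refl
         (p n ℕₚ.≤-refl) (λ i i<n → p i (ℕₚ.<⇒≤ i<n))
... | Δ , Γ⊢∇Δ , Δ⊢worm , Δ⊢ = rest k b
  where
  upto : ∀ i → i ≤ℕ n → Δ ⊢ ∇ i (worm i (seq x i))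
  upto i i≤n with ℕₚ.m≤n⇒m<n∨m≡n i≤n
  ... | inj₁ i<n  = Δ⊢ i i<n
  ... | inj₂ refl = cut Δ⊢worm ∇T
  next : ∀ i → i ≤ℕ suc n → Δ ⊢ ∇ i (worm i (seq x i))
  next i p with ℕₚ.m≤n⇒m<n∨m≡n p
  ... | inj₁ (s≤s i≤n) = upto i i≤n
  ... | inj₂ refl = cut (cut Δ⊢worm (worm-ℓ n (seq x n)))
        (cut ∇T (worm-≽ (suc n) (proj₁ (inS x) (suc n)) (proj₂ (inS x) n)))
  rest : ∀ k → bound x ≤ℕ k + n → _ ⊢ ∇ n A
  rest zero b = cut Γ⊢∇Δ (mono (nab n) (h all))
    where
    all : Describes Δ (seq x)
    all i with i ≤? n
    ... | yes i≤n = upto i i≤n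
    ... | no  i≰n = describes-𝟎 (vanish x i (ℕₚ.≤-trans b (ℕₚ.<⇒≤ (≰⇒> i≰n))))
  rest (suc k) b = cut Γ⊢∇Δ (cut (mono (nab n) (cut Δ⊢∇A (∇mono ℕₚ.≤-refl))) (trans4 (nab n)))
    where
    Δ⊢∇A : Δ ⊢ ∇ (suc n) A
    Δ⊢∇A = ∇-extend x h k (suc n) (subst (bound x ≤ℕ_) (sym (ℕₚ.+-suc k n)) b) next

-- The normal form is an infinite conjunction, hence not a formula; equivalence with it is split
-- into what `A` proves and what suffices to prove `A`.
record Characterises (A : Fm) (α : Seq) : Set where
  field
    describes : Describes A α
    entailed  : ∀ {Γ} → Describes Γ α → Γ ⊢ A
open Characterises

characterises-⊤ : Characterises ⊤' zeroSeq
characterises-⊤ = record { describes = λ _ → ∇T ; entailed = λ _ → top }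

-- `raise-∇` is the syntactic image of the recursion for meets, run downwards from the bound.
characterises-∧ : ∀ {A B} x y → Characterises A (seq x) → Characterises B (seq y) →
  Characterises (A ∧' B) (seq (x ⊓ y))
characterises-∧ {A} {B} x y a b = record
  { describes = down _ (bound (x ⊓ y)) (λ i p → describes-𝟎 (vanish (x ⊓ y) i p)) step
  ; entailed = λ d → ∧I (entailed a (weaken d x (⊓-≤ˡ x y))) (entailed b (weaken d y (⊓-≤ʳ x y)))
  }
  where
  weaken : ∀ {Γ α} → Describes Γ α → ∀ x → α ⊑ seq x → Describes Γ (seq x)
  weaken d x p i = cut (d i) (worm-≽ i (proj₁ (inS x) i) (p i))
  step : ∀ i → A ∧' B ⊢ ∇ (suc i) (worm (suc i) (seq (x ⊓ y) (suc i))) →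
    A ∧' B ⊢ ∇ i (worm i (seq (x ⊓ y) i))
  step i ih rewrite μ-eq x y i =
    raise-∇ i (max (seq x i) (seq y i)) (seq (x ⊓ y) (suc i))
      (max-elim (λ a → A ∧' B ⊢ ∇ i (worm i a)) (seq x i) (seq y i)
        (cut ∧E₁ (describes a i)) (cut ∧E₂ (describes b i))) ih

-- Truncation is harmless for `entailed`: under `∇ n`, `∇-extend` recovers the later coordinates
-- from coordinate `n`.
characterises-∇ : ∀ {A} n x → Characterises A (seq x) → Characterises (∇ n A) (∇I n (seq x))
characterises-∇ {A} n x a = record
  { describes = desc
  ; entailed = λ {Γ} d → ∇-extend x (entailed a) (bound x) n (ℕₚ.m≤m+n _ n)
      (λ i p → subst (λ z → Γ ⊢ ∇ i (worm i z)) (∇I-≤ (seq x) p) (d i))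
  }
  where
  lower : ∀ {i X} → i ≤ℕ n → ∇ n X ⊢ ∇ i X
  lower p with ℕₚ.m≤n⇒m<n∨m≡n p
  ... | inj₁ q = ∇mono q
  ... | inj₂ refl = refl⊢
  desc : Describes (∇ n A) (∇I n (seq x))
  desc i with i ≤? n
  ... | yes p rewrite ∇I-≤ (seq x) p = cut (cut (mono (nab n) (describes a i)) (lower p)) (trans4 (nab i))
  ... | no  p = describes-𝟎 (∇I-> (seq x) (≰⇒> p))

-- For `entailed`: up to `n` the coordinates of `◇I n (seq x)` strictly exceed those of `x`, so each
-- worm yields a `◇ i`. Axiom J gathers these under `◇ n`, and `◇∇◇` removes the `∇ n` left by
-- `∇-extend`.
characterises-◇ : ∀ {A} n x → Characterises A (seq x) → Characterises (◇ n A) (◇I n (seq x))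
characterises-◇ {A} n x a = record { describes = λ i → cut (worms i) ∇T ; entailed = ent }
  where
  lower : ∀ {i X} → i ≤ℕ n → ◇ n X ⊢ ◇ i X
  lower p with ℕₚ.m≤n⇒m<n∨m≡n p
  ... | inj₁ q = ◇mono q
  ... | inj₂ refl = refl⊢
  vanishing : ∀ i → n <ℕ i → ◇ n A ⊢ worm i (◇I n (seq x) i)
  vanishing i p rewrite ◇I-> (seq x) p = top
  -- The worms are proved without `∇`, since `worm-snoc` takes the worm of the next coordinate bare.
  step : ∀ i → ◇ n A ⊢ worm (suc i) (◇I n (seq x) (suc i)) → ◇ n A ⊢ worm i (◇I n (seq x) i)
  step i ih with i ≤? n
  ... | no  p = vanishing i (≰⇒> p)
  ... | yes p rewrite ◇I-≤ (seq x) p = worm-snoc i (seq x i) _ ⊤' ih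
        (cut (lower p) (cut (mono (dia i) (describes a i)) (◇∇◇ ℕₚ.≤-refl)))
  worms : ∀ i → ◇ n A ⊢ worm i (◇I n (seq x) i)
  worms = down _ (suc n) vanishing step
  ent : ∀ {Γ} → Describes Γ (◇I n (seq x)) → Γ ⊢ ◇ n A
  ent {Γ} d 
    with Collect.collect ◇ ◇J (λ i → worm i (seq x i)) n ℕₚ.≤-refl
           (diamonds n ℕₚ.≤-refl) (λ i i<n → diamonds i (ℕₚ.<⇒≤ i<n))
    where
    diamonds : ∀ i → i ≤ℕ n → Γ ⊢ ◇ i (worm i (seq x i))
    diamonds i p = cut (d i) (cut
      (mono (nab i) (wormOn-≻ i _ _ ⊤' (proj₁ (inS x) i) (◇I-≺ (seq x) p))) (∇◇◇ ℕₚ.≤-refl))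
  ... | Δ , Γ⊢◇Δ , Δ⊢worm , Δ⊢ =
    cut Γ⊢◇Δ (cut (mono (dia n) (∇-extend x (entailed a) (bound x) n (ℕₚ.m≤m+n _ n) upto)) (◇∇◇ ℕₚ.≤-refl))
    where
    upto : ∀ i → i ≤ℕ n → Δ ⊢ ∇ i (worm i (seq x i))
    upto i i≤n with ℕₚ.m≤n⇒m<n∨m≡n i≤n
    ... | inj₁ i<n  = cut (Δ⊢ i i<n) ◇∇
    ... | inj₂ refl = cut Δ⊢worm ∇T

-- Completeness.

characterises : ∀ {A} → VarFree A → ∀ v → Characterises A (seq (⟦ A ⟧ v))
characterises ⊤' v = characterises-⊤
characterises {A ∧' B} (a ∧' b) v =
  characterises-∧ (⟦ A ⟧ v) (⟦ B ⟧ v) (characterises a v) (characterises b v)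
characterises {◇ n A} (◇ a) v = characterises-◇ n (⟦ A ⟧ v) (characterises a v)
characterises {∇ n A} (∇ a) v = characterises-∇ n (⟦ A ⟧ v) (characterises a v)

-- Under `∇ i` larger ordinals have stronger worms, so `A` proves every conjunct of the normal form
-- of `B`.
complete : ∀ {A B} → VarFree A → VarFree B → ∀ v → seq (⟦ A ⟧ v) ⊑ seq (⟦ B ⟧ v) → A ⊢ B
complete {B = B} a b v h = entailed (characterises b v)
  λ i → cut (describes (characterises a v) i) (worm-≽ i (proj₁ (inS (⟦ B ⟧ v)) i) (h i))

theorem10 : (A B : Fm) → VarFree A → VarFree B →
    (A ⊢ B → ∀ α β → Val A α → Val B β → α ≤I β)
    × ((∀ α β → Val A α → Val B β → α ≤I β) → A ⊢ B)
theorem10 A B a b =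
  (λ A⊢B α β va vb → ≼⇒≤ₒ ∘
    ⊑-trans (proj₁ (proj₂ (Val-unique va v))) (⊑-trans (sound A⊢B v) (proj₂ (proj₂ (Val-unique vb v))))) ,
  (λ h → complete a b v (≤ₒ⇒≼ ∘ h _ _ (Val-⟦⟧ a v) (Val-⟦⟧ b v)))
  where
  v : ℕ → Elt
  -- A default valuation; `A` and `B` contain no variables.
  v _ = ⊤E
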